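{- Let $f:\{0,1\}^5\to\{0,1\}$ be a radius-$2$ cellular automaton local rule with induced global rule $F$, and suppose there are integers $n_1\ge1$ and $n_2\ge1$ such that the following properties hold for every $L\ge5$: B1) for every $c\in\mathscr{C}_L$ such that $c\notin\{1^L\}$ if $L$ is odd, and $c\notin\{1^L,(01)^{L/2},(10)^{L/2}\}$ if $L$ is even, there is $0\le j\le L-1$ with $(F^{n_1}(c))_{[j,j+1]}=00$; B2) there is $0\le i\le L-1$ such that, for every $c\in\mathscr{C}_L$ and every $0\le j\le L-1$, if $c_{[j,j+1]}=00$ then $(F^{n_2}(c))_{[i+j,i+j+2]}=000$; B3) $f(0,1,0,1,0)=f(1,0,1,0,1)=f(1,1,1,1,1)=1$; B4) $f(0,0,0,0,0)=0$. Then $f$ is a consensus rule and, for every $L\ge5$, $\mathscr{B}_1^L=\{1^L\}$ if $L$ is odd and $\mathscr{B}_1^L=\{1^L,(10)^{L/2},(01)^{L/2}\}$ if $L$ is even.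
   Context: A radius-$2$ (binary, one-dimensional) cellular automaton local rule is a function $f:\{0,1\}^{5}\to\{0,1\}$. A configuration of length $L$ is a cyclic word $c=(c_0,\dots,c_{L-1})\in\{0,1\}^L=:\mathscr{C}_L$, with cell indices taken modulo $L$; $c_{[a,b]}=c_ac_{a+1}\cdots c_b$. The induced global rule $F:\mathscr{C}_L\to\mathscr{C}_L$ is $(F(c))_p=f(c_{p-2},c_{p-1},c_p,c_{p+1},c_{p+2})$, and $F^n$ is its $n$-th iterate. For a block $b$, $b^n$ denotes the concatenation of $n$ copies of $b$. An attractor of length $L$ of $F$ is a nonempty set $X\subseteq\mathscr{C}_L$ with $F(X)=X$ such that any nonempty $Y\subseteq X$ with $F(Y)=Y$ equals $X$ (i.e. a periodic orbit); if $X=\{x\}$ it is a fixed point and is identified with $x$. The basin of attraction of $X$ is $\{c\in\mathscr{C}_L: F^t(c)\in X\text{ for some }t\ge0\}$; $\mathscr{B}^L_x$ denotes the basin of attraction of $x^L$ for $x\in\{0,1\}$. The rule $f$ is a consensus rule if for every $L\ge5$ its only attractors of length $L$ are $0^L$ and $1^L$ (both being attractors). -}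

module Defs where

open import Data.Fin using (Fin; toℕ)
open import Data.Fin.Patterns using (0F; 1F)
open import Data.Fin.Properties using (nonZeroIndex)
open import Data.Nat using (ℕ; _+_; _∸_; _≤_)
open import Data.Nat.Divisibility using (_∣_; divides)
open import Data.Nat.DivMod using (_mod_)
open import Data.Product using (∃; _×_)
open import Data.Sum using (_⊎_)
open import Data.Vec using (Vec; []; _∷_; cast; concat; lookup; replicate; tabulate)
open import Function.Endo.Propositional using (_^_)
open import Level using (0ℓ)
open import Relation.Binary.PropositionalEquality using (_≡_; sym)
open import Relation.Unary using (Pred; Satisfiable; ｛_｝; _∈_; _⊆_; _≐_)

Cell : Set
Cell = Fin 2

Rule : Set
Rule = Vec Cell 5 → Cell

Config : ℕ → Set
Config L = Vec Cell L

infixl 6 _⊕_ _⊖_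

_⊕_ : ∀ {L} → Fin L → ℕ → Fin L
_⊕_ {L} p k = _mod_ (toℕ p + k) L {{nonZeroIndex p}}

-- Subtraction modulo L; it has this meaning only for k ≤ L.
_⊖_ : ∀ {L} → Fin L → ℕ → Fin L
_⊖_ {L} p k = p ⊕ (L ∸ k)

-- The word c_a c_{a+1} ⋯ c_{a+n-1}, with indices modulo L.
-- The last argument is the length n of the word, not its right endpoint.
block : ∀ {L} → Config L → Fin L → (n : ℕ) → Vec Cell n
block c a n = tabulate λ k → lookup c (a ⊕ toℕ k)

-- b ^ (L / m) as a configuration of length L, for a block b of length m.
power : ∀ {m L} → Vec Cell m → m ∣ L → Config L
power b (divides q L≡q*m) = cast (sym L≡q*m) (concat (replicate q b))

global : Rule → ∀ {L} → Config L → Config L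
global f c = tabulate λ p →
  f (lookup c (p ⊖ 2) ∷ lookup c (p ⊖ 1) ∷ lookup c p ∷
     lookup c (p ⊕ 1) ∷ lookup c (p ⊕ 2) ∷ [])

iter : ∀ {L} → (Config L → Config L) → ℕ → Config L → Config L
iter {L} F n = _^_ (Config L) F n

image : ∀ {L} → (Config L → Config L) → Pred (Config L) 0ℓ → Pred (Config L) 0ℓ
image F X d = ∃ λ c → c ∈ X × F c ≡ d

record Attractor {L} (F : Config L → Config L) (X : Pred (Config L) 0ℓ) : Set₁ where
  field
    nonempty  : Satisfiable X
    invariant : image F X ≐ X
    minimal   : (Y : Pred (Config L) 0ℓ) → Satisfiable Y → Y ⊆ X →
                image F Y ≐ Y → Y ≐ X

Basin : ∀ {L} → (Config L → Config L) → Pred (Config L) 0ℓ → Pred (Config L) 0ℓ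
Basin F X c = ∃ λ t → iter F t c ∈ X

𝓑 : Rule → (L : ℕ) → Cell → Pred (Config L) 0ℓ
𝓑 f L x = Basin (global f) ｛ replicate L x ｝

record IsConsensus (f : Rule) : Set₁ where
  field
    zeros : ∀ L → 5 ≤ L → Attractor (global f) ｛ replicate L 0F ｝
    ones  : ∀ L → 5 ≤ L → Attractor (global f) ｛ replicate L 1F ｝
    only  : ∀ L → 5 ≤ L → (X : Pred (Config L) 0ℓ) → Attractor (global f) X →
            X ≐ ｛ replicate L 0F ｝ ⊎ X ≐ ｛ replicate L 1F ｝

{-# OPTIONS --safe #-}

-- Under F^n₂ a run of at least two zeros moves by the shift i and grows by one
-- cell, since its overlapping blocks 00 each produce a block 000. A
-- configuration outside the exceptional set acquires a block 00 after n₁ steps,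
-- hence ends in 0^L, whereas an exceptional configuration is mapped to 1^L by
-- B3. So every configuration is in the basin of one of these two fixed points,
-- and an attractor containing it must be that fixed point.
module Submission where

open import Data.Empty using (⊥-elim)
open import Data.Fin using (Fin; zero; suc; toℕ; fromℕ<; _≟_)
open import Data.Fin.Patterns using (0F; 1F; 2F; 3F; 4F)
open import Data.Fin.Properties using (nonZeroIndex; toℕ-fromℕ<; toℕ-injective; toℕ<n)
open import Data.Nat using (ℕ; zero; suc; _+_; _*_; _∸_; _%_; _/_; _≤_; _<_; NonZero; z≤n; s≤s)
open import Data.Nat.Divisibility using (_∣_; divides; divides-refl; _∣?_)
open import Data.Nat.DivMod
  using (m≡m%n+[m/n]*n; m%n<n; m<n⇒m%n≡m; m%n%n≡m%n; [m+n]%n≡m%n; %-distribˡ-+)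
open import Data.Nat.Properties
  using (+-assoc; +-comm; *-cancelʳ-≡; m+[n∸m]≡n; m≤n+m; +-mono-≤; *-assoc; ≤-trans; <⇒≤; ≡-irrelevant)
open import Data.Product using (∃; _×_; _,_; proj₁)
open import Data.Sum using (_⊎_; inj₁; inj₂; [_,_])
import Data.Sum as Sum
open import Data.Vec using (Vec; []; _∷_; concat; lookup; replicate; tabulate)
open import Data.Vec.Properties
  using (cast-is-id; lookup-replicate; lookup∘tabulate; tabulate∘lookup; tabulate-cong; ≡-dec)
open import Defs
open import Function.Base using (_∘_; _∋_; id)
open import Function.Endo.Propositional using (^-homo)
open import Relation.Binary.PropositionalEquality
  using (_≡_; refl; sym; trans; cong; cong₂; cong-app; subst; module ≡-Reasoning)
open import Relation.Nullary using (¬_; Dec; yes; no)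
open import Relation.Nullary.Decidable using (_⊎-dec_; map′)
open import Relation.Unary using (Pred; ｛_｝; _∉_; _∪_; _∈_; _⊆_; _≐_)
open import Relation.Unary.Properties using (≐-sym)

open ≡-Reasoning

private
  variable
    L m : ℕ

-- Vector extensionality and uniqueness of divisibility proofs.

lookup-ext : {A : Set} {xs ys : Vec A m} → (∀ i → lookup xs i ≡ lookup ys i) → xs ≡ ys
lookup-ext {xs = xs} {ys} eq =
  trans (sym (tabulate∘lookup xs)) (trans (tabulate-cong eq) (tabulate∘lookup ys))

-- `power` depends on a divisibility proof, so words built from different proofs have to be
-- identified. Cancelling `m` fixes the quotient, and equations between naturals have at most one
-- proof.
∣-irrelevant : .{{_ : NonZero m}} (d e : m ∣ L) → d ≡ e
∣-irrelevant {m} (divides-refl q) (divides r eq) with *-cancelʳ-≡ q r m eq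
... | refl = cong (divides q) (≡-irrelevant refl eq)

-- Cell indices modulo `L`.

toℕ-⊕ : .{{_ : NonZero L}} (p : Fin L) (k : ℕ) → toℕ (p ⊕ k) ≡ (toℕ p + k) % L
toℕ-⊕ {L} p k = toℕ-fromℕ< (m%n<n (toℕ p + k) L {{nonZeroIndex p}})

%-+-congˡ : ∀ {a b} n d .{{_ : NonZero d}} → a % d ≡ b % d → (a + n) % d ≡ (b + n) % d
%-+-congˡ {a} {b} n d eq =
  trans (%-distribˡ-+ a n d) (trans (cong (λ x → (x + n % d) % d) eq) (sym (%-distribˡ-+ b n d)))

⊕-assoc : (p : Fin L) (k l : ℕ) → p ⊕ k ⊕ l ≡ p ⊕ (k + l)
⊕-assoc {L} p k l = toℕ-injective (begin
  toℕ (p ⊕ k ⊕ l)           ≡⟨ toℕ-⊕ (p ⊕ k) l ⟩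
  (toℕ (p ⊕ k) + l) % L     ≡⟨ cong (λ x → (x + l) % L) (toℕ-⊕ p k) ⟩
  ((toℕ p + k) % L + l) % L ≡⟨ %-+-congˡ l L (m%n%n≡m%n (toℕ p + k) L) ⟩
  (toℕ p + k + l) % L       ≡⟨ cong (_% L) (+-assoc (toℕ p) k l) ⟩
  (toℕ p + (k + l)) % L     ≡⟨ toℕ-⊕ p (k + l) ⟨
  toℕ (p ⊕ (k + l))         ∎)
  where instance _ = nonZeroIndex p

⊕-comm : (p q : Fin L) → p ⊕ toℕ q ≡ q ⊕ toℕ p
⊕-comm {L} p q = toℕ-injective (begin
  toℕ (p ⊕ toℕ q)       ≡⟨ toℕ-⊕ p (toℕ q) ⟩
  (toℕ p + toℕ q) % L   ≡⟨ cong (_% L) (+-comm (toℕ p) (toℕ q)) ⟩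
  (toℕ q + toℕ p) % L   ≡⟨ toℕ-⊕ q (toℕ p) ⟨
  toℕ (q ⊕ toℕ p)       ∎)
  where instance _ = nonZeroIndex p

-- With `p` the shift of B2 and `q` the start of a run, this turns a position in the image of the
-- block at `q ⊕ k` into an offset from the shifted start `p ⊕ toℕ q`.
⊕-toℕ-⊕ : (p q : Fin L) (k l : ℕ) → p ⊕ toℕ (q ⊕ k) ⊕ l ≡ p ⊕ toℕ q ⊕ (k + l)
⊕-toℕ-⊕ p q k l = begin
  p ⊕ toℕ (q ⊕ k) ⊕ l   ≡⟨ cong (_⊕ l) (⊕-comm p (q ⊕ k)) ⟩
  q ⊕ k ⊕ toℕ p ⊕ l     ≡⟨ cong (_⊕ l) (⊕-assoc q k (toℕ p)) ⟩
  q ⊕ (k + toℕ p) ⊕ l   ≡⟨ cong (λ x → q ⊕ x ⊕ l) (+-comm k (toℕ p)) ⟩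
  q ⊕ (toℕ p + k) ⊕ l   ≡⟨ cong (_⊕ l) (⊕-assoc q (toℕ p) k) ⟨
  q ⊕ toℕ p ⊕ k ⊕ l     ≡⟨ cong (λ x → x ⊕ k ⊕ l) (⊕-comm q p) ⟩
  p ⊕ toℕ q ⊕ k ⊕ l     ≡⟨ ⊕-assoc (p ⊕ toℕ q) k l ⟩
  p ⊕ toℕ q ⊕ (k + l)   ∎

⊕-surjective : (a p : Fin L) → ∃ λ k → k < L × a ⊕ k ≡ p
⊕-surjective {L} a p = toℕ k , toℕ<n k , (begin
  a ⊕ toℕ k                     ≡⟨ ⊕-comm a k ⟩
  p ⊕ (L ∸ toℕ a) ⊕ toℕ a       ≡⟨ ⊕-assoc p (L ∸ toℕ a) (toℕ a) ⟩
  p ⊕ (L ∸ toℕ a + toℕ a)       ≡⟨ cong (p ⊕_) (+-comm (L ∸ toℕ a) (toℕ a)) ⟩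
  p ⊕ (toℕ a + (L ∸ toℕ a))     ≡⟨ cong (p ⊕_) (m+[n∸m]≡n (<⇒≤ (toℕ<n a))) ⟩
  p ⊕ L                         ≡⟨ toℕ-injective
    (trans (toℕ-⊕ p L) (trans ([m+n]%n≡m%n (toℕ p) L) (m<n⇒m%n≡m (toℕ<n p)))) ⟩
  p                             ∎)
  where
  instance _ = nonZeroIndex p
  -- The difference of `p` and `a` modulo `L`; as an element of `Fin L` its value is below `L`.
  k = p ⊖ toℕ a

-- Iteration, basins and attractors of an arbitrary map.

module _ (F : Config L → Config L) where

  iter-+ : ∀ s t c → iter F (s + t) c ≡ iter F s (iter F t c)
  iter-+ s t = cong-app (^-homo (Config L) F s t)

  iter-fixed : ∀ {x} → F x ≡ x → ∀ t → iter F t x ≡ x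
  iter-fixed Fx zero    = refl
  iter-fixed Fx (suc t) = trans (cong F (iter-fixed Fx t)) Fx

  -- By time `s + t` the orbit of `c` has reached both fixed points, and it never leaves a fixed
  -- point.
  basin-disjoint : ∀ {x y c} → F x ≡ x → F y ≡ y →
    c ∈ Basin F ｛ x ｝ → c ∈ Basin F ｛ y ｝ → x ≡ y
  basin-disjoint {x} {y} {c} Fx Fy (s , xs) (t , yt) = begin
    x                        ≡⟨ iter-fixed Fx t ⟨
    iter F t x               ≡⟨ cong (iter F t) xs ⟩
    iter F t (iter F s c)    ≡⟨ iter-+ t s c ⟨
    iter F (t + s) c         ≡⟨ cong (λ n → iter F n c) (+-comm t s) ⟩
    iter F (s + t) c         ≡⟨ iter-+ s t c ⟩
    iter F s (iter F t c)    ≡⟨ cong (iter F s) yt ⟨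
    iter F s y               ≡⟨ iter-fixed Fy s ⟩
    y                        ∎

  image-fixed : ∀ {x} → F x ≡ x → image F ｛ x ｝ ≐ ｛ x ｝
  image-fixed Fx = (λ { (_ , refl , refl) → sym Fx }) , λ { refl → _ , refl , Fx }

  fixed-attractor : ∀ {x} → F x ≡ x → Attractor F ｛ x ｝
  fixed-attractor {x} Fx = record
    { nonempty  = x , refl
    ; invariant = image-fixed Fx
    ; minimal   = λ Y (y , y∈Y) Y⊆x _ →
        Y⊆x , λ x≡z → subst Y (trans (sym (Y⊆x y∈Y)) x≡z) y∈Y
    }

  iter-closed : ∀ {X} → image F X ⊆ X → ∀ {c} → c ∈ X → ∀ t → iter F t c ∈ X
  iter-closed FX⊆X c∈X zero    = c∈X
  iter-closed FX⊆X c∈X (suc t) = FX⊆X (_ , iter-closed FX⊆X c∈X t , refl)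

  -- `X` is closed under `F`, so the orbit of `c` carries `x` into `X`. Then the singleton of `x` is
  -- a nonempty invariant subset of `X`, and minimality applies.
  attractor-meeting-basin : ∀ {X x c} → F x ≡ x → Attractor F X →
    c ∈ X → c ∈ Basin F ｛ x ｝ → X ≐ ｛ x ｝
  attractor-meeting-basin {X} {x} Fx att c∈X (t , eq) =
    ≐-sym (minimal ｛ x ｝ (x , refl) (λ { refl → x∈X }) (image-fixed Fx))
    where
    open Attractor att
    x∈X = subst X (sym eq) (iter-closed (proj₁ invariant) c∈X t)

-- Words of period two.

alternate : {A : Set} → A → A → ℕ → A
alternate a b zero    = a
-- Exchanging the letters makes a move by one cell a definitional equality.
alternate a b (suc n) = alternate b a n

alternate-+2* : {A : Set} (a b : A) (n k : ℕ) → alternate a b (n + k * 2) ≡ alternate a b n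
alternate-+2* a b zero    zero    = refl
alternate-+2* a b zero    (suc k) = alternate-+2* a b zero k
alternate-+2* a b (suc n) k       = alternate-+2* b a n k

-- Reduction modulo an even number keeps the parity, so the pattern is consistent across the
-- wrap-around.
alternate-% : {A : Set} (a b : A) (n q : ℕ) .{{_ : NonZero (q * 2)}} →
  alternate a b (n % (q * 2)) ≡ alternate a b n
alternate-% a b n q = begin
  alternate a b (n % d)                 ≡⟨ alternate-+2* a b (n % d) (n / d * q) ⟨
  alternate a b (n % d + n / d * q * 2) ≡⟨ cong (λ x → alternate a b (n % d + x)) (*-assoc (n / d) q 2) ⟩
  alternate a b (n % d + n / d * d)     ≡⟨ cong (alternate a b) (m≡m%n+[m/n]*n n d) ⟨
  alternate a b n                       ∎
  where d = q * 2

lookup-concat-replicate : {A : Set} (a b : A) (q : ℕ) (p : Fin (q * 2)) →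
  lookup (concat (replicate q (a ∷ b ∷ []))) p ≡ alternate a b (toℕ p)
lookup-concat-replicate a b (suc q) zero          = refl
lookup-concat-replicate a b (suc q) (suc zero)    = refl
lookup-concat-replicate a b (suc q) (suc (suc p)) = lookup-concat-replicate a b q p

lookup-power : (a b : Cell) (even : 2 ∣ L) (p : Fin L) →
  lookup (power (a ∷ b ∷ []) even) p ≡ alternate a b (toℕ p)
-- Matching turns `L` into `q * 2`, so the `cast` inside `power` runs along `refl`.
lookup-power a b (divides-refl q) p =
  trans (cong (λ c → lookup c p) (cast-is-id refl (concat (replicate q (a ∷ b ∷ [])))))
        (lookup-concat-replicate a b q p)

lookup-power-⊕ : (a b : Cell) (even : 2 ∣ L) (p : Fin L) (k : ℕ) →
  lookup (power (a ∷ b ∷ []) even) (p ⊕ k) ≡ alternate a b (toℕ p + k)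
lookup-power-⊕ a b even@(divides-refl q) p k = begin
  lookup (power (a ∷ b ∷ []) even) (p ⊕ k)    ≡⟨ lookup-power a b even (p ⊕ k) ⟩
  alternate a b (toℕ (p ⊕ k))                 ≡⟨ cong (alternate a b) (toℕ-⊕ p k) ⟩
  alternate a b ((toℕ p + k) % (q * 2))       ≡⟨ alternate-% a b (toℕ p + k) q ⟩
  alternate a b (toℕ p + k)                   ∎
  where instance _ = nonZeroIndex p

-- The global rule on constant and alternating configurations.

module _ (f : Rule) where

  global-replicate : ∀ {x} → f (replicate 5 x) ≡ x →
    global f (replicate L x) ≡ replicate L x
  global-replicate {x = x} fx = lookup-ext λ p → begin
    lookup (global f (replicate _ x)) p ≡⟨ lookup∘tabulate _ p ⟩
    f _                                 ≡⟨ cong f (lookup-ext λ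
      { 0F → lookup-replicate (p ⊖ 2) x
      ; 1F → lookup-replicate (p ⊖ 1) x
      ; 2F → lookup-replicate p x
      ; 3F → lookup-replicate (p ⊕ 1) x
      ; 4F → lookup-replicate (p ⊕ 2) x }) ⟩
    f (replicate 5 x)                   ≡⟨ fx ⟩
    x                                   ≡⟨ lookup-replicate p x ⟨
    lookup (replicate _ x) p            ∎

  private
    zigzag : Cell → Cell → Vec Cell 5
    zigzag a b = a ∷ b ∷ a ∷ b ∷ a ∷ []

  -- Moving on by one cell exchanges the two neighbourhoods, so the two hypotheses trade places in
  -- the induction.
  rule-zigzag : ∀ {a b y} → f (zigzag a b) ≡ y → f (zigzag b a) ≡ y →
    ∀ n → f (zigzag (alternate a b n) (alternate b a n)) ≡ y
  rule-zigzag ab ba zero    = ab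
  rule-zigzag ab ba (suc n) = rule-zigzag ba ab n

  global-power : ∀ {a b y} → f (zigzag a b) ≡ y → f (zigzag b a) ≡ y →
    (even : 2 ∣ L) → global f (power (a ∷ b ∷ []) even) ≡ replicate L y
  global-power {L} {a} {b} {y} ab ba even = lookup-ext λ p → begin
    lookup (global f c) p ≡⟨ lookup∘tabulate _ p ⟩
    f _                   ≡⟨ cong f (neighbourhood even p) ⟩
    f (zigzag (alternate a b (toℕ p)) (alternate b a (toℕ p)))
                          ≡⟨ rule-zigzag ab ba (toℕ p) ⟩
    y                     ≡⟨ lookup-replicate p y ⟨
    lookup (replicate L y) p ∎
    where
    c = power (a ∷ b ∷ []) even

    +1 : ∀ n → alternate a b (n + 1) ≡ alternate b a n
    +1 n = cong (alternate a b) (+-comm n 1)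

    +2 : ∀ n → alternate a b (n + 2) ≡ alternate a b n
    +2 n = cong (alternate a b) (+-comm n 2)

    neighbourhood : (even : 2 ∣ L) (p : Fin L) → let c = power (a ∷ b ∷ []) even in
      lookup c (p ⊖ 2) ∷ lookup c (p ⊖ 1) ∷ lookup c p ∷ lookup c (p ⊕ 1) ∷ lookup c (p ⊕ 2) ∷ []
      ≡ zigzag (alternate a b (toℕ p)) (alternate b a (toℕ p))
    -- A cell `p` exists, so the quotient is positive. With `L` equal to `2 + q * 2`, the left moves
    -- by 2 and 1 compute to right moves by `q * 2` and `1 + q * 2`.
    neighbourhood even@(divides-refl (suc q)) p = lookup-ext λ
      { 0F → trans (lookup-power-⊕ a b even p (q * 2)) (alternate-+2* a b (toℕ p) q)
      ; 1F → trans (lookup-power-⊕ a b even p (1 + q * 2))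
               (trans (cong (alternate a b) (sym (+-assoc (toℕ p) 1 (q * 2))))
                 (trans (alternate-+2* a b (toℕ p + 1) q) (+1 (toℕ p))))
      ; 2F → lookup-power a b even p
      ; 3F → trans (lookup-power-⊕ a b even p 1) (+1 (toℕ p))
      ; 4F → trans (lookup-power-⊕ a b even p 2) (+2 (toℕ p)) }

-- The exceptional configurations.

Alternating : 2 ∣ L → Pred (Config L) _
Alternating even = ｛ power (0F ∷ 1F ∷ []) even ｝ ∪ ｛ power (1F ∷ 0F ∷ []) even ｝

Alternating-irrelevant : (d e : 2 ∣ L) → Alternating d ⊆ Alternating e
Alternating-irrelevant d e = subst (λ even → _ ∈ Alternating even) (∣-irrelevant d e)

-- Packing the evenness proof into the predicate treats both parities at once: for odd `L` the
-- second part is empty.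
Exceptional : Pred (Config L) _
Exceptional {L} = ｛ replicate L 1F ｝ ∪ λ c → ∃ λ (even : 2 ∣ L) → c ∈ Alternating even

-- Makes the case split between the two basins constructive.
exceptional? : (c : Config L) → Dec (Exceptional c)
exceptional? {L} c = (replicate L 1F ≟ᶜ c) ⊎-dec alternating?
  where
  _≟ᶜ_ = ≡-dec (_≟_ {2})

  alternating? : Dec (∃ λ (even : 2 ∣ L) → c ∈ Alternating even)
  alternating? with 2 ∣? L
  ... | no odd   = no (odd ∘ proj₁)
  ... | yes even = map′ (even ,_) (λ (even′ , alt) → Alternating-irrelevant even′ even alt)
    ((_ ≟ᶜ c) ⊎-dec (_ ≟ᶜ c))

-- Growth of runs of zeros.

ZeroRun : Config L → Fin L → ℕ → Set
-- Offsets are bounded naturals, which can be split as sums; `n` may exceed `L`, and the run then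
-- wraps around the cycle.
ZeroRun c a n = ∀ k → k < n → lookup c (a ⊕ k) ≡ 0F

block-zeros⇒lookup : (c : Config L) (a : Fin L) → block c a m ≡ replicate m 0F →
  (k : Fin m) → lookup c (a ⊕ toℕ k) ≡ 0F
block-zeros⇒lookup c a eq k =
  trans (sym (lookup∘tabulate _ k)) (trans (cong (λ b → lookup b k) eq) (lookup-replicate k 0F))

block-zeros⇒run : (c : Config L) (a : Fin L) → block c a m ≡ replicate m 0F → ZeroRun c a m
block-zeros⇒run c a eq k k<m =
  subst (λ x → lookup c (a ⊕ x) ≡ 0F) (toℕ-fromℕ< k<m) (block-zeros⇒lookup c a eq (fromℕ< k<m))

-- Every cell is reached from `a` by an offset below `L`, hence lies in the run.
full-run⇒zeros : (c : Config L) {a : Fin L} → L ≤ m → ZeroRun c a m → replicate L 0F ≡ c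
full-run⇒zeros c {a} L≤m run = lookup-ext λ p → let k , k<L , a⊕k≡p = ⊕-surjective a p in
  trans (lookup-replicate p 0F)
    (sym (trans (cong (lookup c) (sym a⊕k≡p)) (run k (≤-trans k<L L≤m))))

-- The windows of length 3 starting at `0` to `n` cover all `3 + n` offsets. The recursion picks the
-- start `k′` as the minimum of `k` and `n`.
window-cover : ∀ n k → k < 3 + n → ∃ λ k′ → ∃ λ (e : Fin 3) → k′ ≤ n × k′ + toℕ e ≡ k
window-cover zero    k       k<3         = 0 , fromℕ< k<3 , z≤n , toℕ-fromℕ< k<3
window-cover (suc n) zero    _           = 0 , 0F , z≤n , refl
window-cover (suc n) (suc k) (s≤s k<3+n) =
  let k′ , e , k′≤n , eq = window-cover n k k<3+n in suc k′ , e , s≤s k′≤n , cong suc eq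

module _ (G : Config L → Config L) (i : Fin L)
  (spread : ∀ c j → block c j 2 ≡ replicate 2 0F → block (G c) (i ⊕ toℕ j) 3 ≡ replicate 3 0F)
  where

  -- A run of length `2 + n` contains a block 00 at each offset `k′ ≤ n`. Their images 000 are the
  -- windows of `window-cover`, so each offset below `3 + n` receives a zero.
  run-grows : ∀ c a n → ZeroRun c a (2 + n) → ZeroRun (G c) (i ⊕ toℕ a) (3 + n)
  run-grows c a n run k k<3+n with window-cover n k k<3+n
  ... | k′ , e , k′≤n , refl =
    trans (cong (lookup (G c)) (sym (⊕-toℕ-⊕ i a k′ (toℕ e))))
      (block-zeros⇒lookup (G c) (i ⊕ toℕ (a ⊕ k′)) (spread c (a ⊕ k′) zeros) e)
    where
    zero-at : ∀ d → d ≤ 1 → lookup c (a ⊕ k′ ⊕ d) ≡ 0F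
    zero-at d d≤1 = trans (cong (lookup c) (trans (⊕-assoc a k′ d) (cong (a ⊕_) (+-comm k′ d))))
      (run (d + k′) (s≤s (+-mono-≤ d≤1 k′≤n)))

    zeros : block c (a ⊕ k′) 2 ≡ replicate 2 0F
    zeros = cong₂ (λ x y → x ∷ y ∷ []) (zero-at 0 z≤n) (zero-at 1 (s≤s z≤n))

  iterated-run : ∀ c a → ZeroRun c a 2 → ∀ t → ∃ λ b → ZeroRun (iter G t c) b (2 + t)
  iterated-run c a run zero = _ , run
  iterated-run c a run (suc t) =
    let b , run′ = iterated-run c a run t in i ⊕ toℕ b , run-grows _ b t run′

  block-00⇒zeros : ∀ c j → block c j 2 ≡ replicate 2 0F → iter G L c ∈ ｛ replicate L 0F ｝
  block-00⇒zeros c j 00-at-j =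
    -- After `L` applications of `G` the run has length `2 + L`, which is at least `L` without any
    -- assumption on `L`.
    let _ , run = iterated-run c j (block-zeros⇒run c j 00-at-j) L
    in full-run⇒zeros (iter G L c) (m≤n+m L 2) run

iter-* : (F : Config L → Config L) (n t : ℕ) (c : Config L) →
  iter F (t * n) c ≡ iter (iter F n) t c
iter-* F n zero    c = refl
iter-* F n (suc t) c = trans (iter-+ F n (t * n) c) (cong (iter F n) (iter-* F n t c))

block-00⇒zero-basin : (F : Config L → Config L) (s n : ℕ) (i : Fin L) →
  (∀ c j → block c j 2 ≡ replicate 2 0F → block (iter F n c) (i ⊕ toℕ j) 3 ≡ replicate 3 0F) →
  ∀ c j → block (iter F s c) j 2 ≡ replicate 2 0F → c ∈ Basin F ｛ replicate L 0F ｝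
-- `s` steps create the block 00, then `L` rounds of `n` steps spread it over the cycle.
block-00⇒zero-basin {L} F s n i spread c j 00-at-j = L * n + s , (begin
  replicate L 0F                 ≡⟨ block-00⇒zeros (iter F n) i spread (iter F s c) j 00-at-j ⟩
  iter (iter F n) L (iter F s c) ≡⟨ iter-* F n L (iter F s c) ⟨
  iter F (L * n) (iter F s c)    ≡⟨ iter-+ F (L * n) s c ⟨
  iter F (L * n + s) c           ∎)

-- Consensus and the basin of the all-one configuration.

zeros≢ones : 5 ≤ L → ¬ (Config L ∋ replicate L 0F) ≡ replicate L 1F
zeros≢ones (s≤s _) ()

corollary6 : (f : Rule) (n₁ n₂ : ℕ) → 1 ≤ n₁ → 1 ≤ n₂ →
    (∀ L → 5 ≤ L → (c : Config L) →
    (¬ 2 ∣ L → c ∉ ｛ replicate L 1F ｝) →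
    ((even : 2 ∣ L) →
    c ∉ ｛ replicate L 1F ｝ ∪ ｛ power (0F ∷ 1F ∷ []) even ｝ ∪ ｛ power (1F ∷ 0F ∷ []) even ｝) →
    ∃ λ (j : Fin L) → block (iter (global f) n₁ c) j 2 ≡ 0F ∷ 0F ∷ []) →
    (∀ L → 5 ≤ L →
    ∃ λ (i : Fin L) → (c : Config L) (j : Fin L) →
    block c j 2 ≡ 0F ∷ 0F ∷ [] →
    block (iter (global f) n₂ c) (i ⊕ toℕ j) 3 ≡ 0F ∷ 0F ∷ 0F ∷ []) →
    f (0F ∷ 1F ∷ 0F ∷ 1F ∷ 0F ∷ []) ≡ 1F →
    f (1F ∷ 0F ∷ 1F ∷ 0F ∷ 1F ∷ []) ≡ 1F →
    f (1F ∷ 1F ∷ 1F ∷ 1F ∷ 1F ∷ []) ≡ 1F →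
    f (0F ∷ 0F ∷ 0F ∷ 0F ∷ 0F ∷ []) ≡ 0F →
    IsConsensus f ×
    (∀ L → 5 ≤ L →
    (¬ 2 ∣ L → 𝓑 f L 1F ≐ ｛ replicate L 1F ｝) ×
    ((even : 2 ∣ L) →
    𝓑 f L 1F ≐ ｛ replicate L 1F ｝ ∪ ｛ power (1F ∷ 0F ∷ []) even ｝ ∪ ｛ power (0F ∷ 1F ∷ []) even ｝))
corollary6 f n₁ n₂ _ _ B1 B2 f01 f10 f11 f00 = consensus , λ L 5≤L → odd-basin L 5≤L , even-basin L 5≤L
  where
  F0 : ∀ L → global f (replicate L 0F) ≡ replicate L 0F
  F0 L = global-replicate f f00

  F1 : ∀ L → global f (replicate L 1F) ≡ replicate L 1F
  F1 L = global-replicate f f11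

  exceptional⇒𝓑₁ : ∀ {L} {c : Config L} → Exceptional c → c ∈ 𝓑 f L 1F
  exceptional⇒𝓑₁ (inj₁ refl)               = 0 , refl
  exceptional⇒𝓑₁ (inj₂ (even , inj₁ refl)) = 1 , sym (global-power f f01 f10 even)
  exceptional⇒𝓑₁ (inj₂ (even , inj₂ refl)) = 1 , sym (global-power f f10 f01 even)

  unexceptional⇒𝓑₀ : ∀ {L} → 5 ≤ L → {c : Config L} → ¬ Exceptional c → c ∈ 𝓑 f L 0F
  unexceptional⇒𝓑₀ {L} 5≤L {c} ¬exc =
    let
      -- The exclusions that B1 demands for odd and for even length both follow from `¬exc`.
      j , 00-at-j = B1 L 5≤L c (λ _ → ¬exc ∘ inj₁) (λ even → ¬exc ∘ Sum.map₂ (even ,_))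
      i , spread = B2 L 5≤L
    in block-00⇒zero-basin (global f) n₁ n₂ i spread c j 00-at-j

  -- Otherwise `c` would also lie in the basin of the all-zero configuration, and the two distinct
  -- fixed points would share a basin element.
  𝓑₁⇒exceptional : ∀ {L} → 5 ≤ L → {c : Config L} → c ∈ 𝓑 f L 1F → Exceptional c
  𝓑₁⇒exceptional 5≤L {c} c∈𝓑₁ with exceptional? c
  ... | yes exc = exc
  ... | no ¬exc = ⊥-elim (zeros≢ones 5≤L
    (basin-disjoint (global f) (F0 _) (F1 _) (unexceptional⇒𝓑₀ 5≤L ¬exc) c∈𝓑₁))

  consensus : IsConsensus f
  consensus = record
    { zeros = λ L _ → fixed-attractor (global f) (F0 L)
    ; ones  = λ L _ → fixed-attractor (global f) (F1 L)
    ; only  = only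
    }
    where
    only : ∀ L → 5 ≤ L → (X : Pred (Config L) _) → Attractor (global f) X →
           X ≐ ｛ replicate L 0F ｝ ⊎ X ≐ ｛ replicate L 1F ｝
    only L 5≤L X att with c , c∈X ← Attractor.nonempty att with exceptional? c
    ... | yes exc = inj₂ (attractor-meeting-basin (global f) (F1 L) att c∈X (exceptional⇒𝓑₁ exc))
    ... | no ¬exc = inj₁ (attractor-meeting-basin (global f) (F0 L) att c∈X (unexceptional⇒𝓑₀ 5≤L ¬exc))

  odd-basin : ∀ L → 5 ≤ L → ¬ 2 ∣ L → 𝓑 f L 1F ≐ ｛ replicate L 1F ｝
  odd-basin L 5≤L odd =
    [ id , ⊥-elim ∘ odd ∘ proj₁ ] ∘ 𝓑₁⇒exceptional 5≤L , exceptional⇒𝓑₁ ∘ inj₁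

  even-basin : ∀ L → 5 ≤ L → (even : 2 ∣ L) →
    𝓑 f L 1F ≐ ｛ replicate L 1F ｝ ∪ ｛ power (1F ∷ 0F ∷ []) even ｝ ∪ ｛ power (0F ∷ 1F ∷ []) even ｝
  even-basin L 5≤L even =
    -- The evenness proof found in `Exceptional` is replaced by the given one; the swap is there
    -- because the conclusion lists the two alternating words in the opposite order.
    Sum.map₂ (λ (even′ , alt) → Sum.swap (Alternating-irrelevant even′ even alt)) ∘
      𝓑₁⇒exceptional 5≤L ,
    exceptional⇒𝓑₁ ∘ Sum.map₂ (λ alt → even , Sum.swap alt)
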